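{- Fix integers $s,t\geq 2$ and a subset $W=\{w_1<w_2<\cdots<w_k\}$ of $\{s+1,\ldots,st\}$. Let $\Omega_{s,t}(W)$ be the collection of all sets of integers $I=\{i_1<i_2<\cdots<i_k\}$ satisfying $w_\ell-s+\ell\leq i_\ell\leq w_\ell-1$ for all $\ell\in[k]$, and let $\Lambda_{s,t}(W)$ be the set of all $321$-avoiding linear extensions of $K_{s,t}^\alpha$ whose right-to-left minima are precisely the elements of $[st]\setminus W$. For $I\in\Omega_{s,t}(W)$ let $\mu_W(I)=\mu_1\cdots\mu_{st}$ be the permutation of $[st]$ with $\mu_{i_\ell}=w_\ell$ for all $\ell\in[k]$ and with the elements of $[st]\setminus W$ placed in increasing order in the remaining positions. Then $I\mapsto\mu_W(I)$ is a well-defined injection $\Omega_{s,t}(W)\to\Lambda_{s,t}(W)$. If $t=2$, this map is a bijection.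
   Context: $K^\alpha_{s,t}$ is the poset on $[st]$ whose order is generated by the covering relations $i\lessdot i+1$ for $1\le i\le s-1$ and $i\lessdot i+s$ for $1\le i\le st-s$ (the comb $K_{s,t}$ with $\alpha$-labeling $e_{i,j}\mapsto (j-1)s+i$). A linear extension is a permutation of $[st]$ in which $x$ precedes $y$ whenever $x<y$ in the poset. An entry $\pi_i$ is a right-to-left minimum if $\pi_i<\pi_j$ for all $j>i$. -}

module Defs where

open import Data.Nat.Base as ℕ using (ℕ; suc; _≤_)
open import Data.Integer.Base as ℤ using (ℤ; +_)
open import Data.Fin.Base as Fin using (Fin; toℕ; _<_)
open import Data.Fin.Permutation using (Permutation′; _⟨$⟩ʳ_; _⟨$⟩ˡ_; _≈_)
open import Data.Product.Base using (∃-syntax; _×_)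
open import Function.Bundles using (_⇔_)
open import Relation.Binary.Construct.Closure.Transitive using (TransClosure)
open import Relation.Binary.Core using (_Preserves_⟶_)
open import Relation.Binary.PropositionalEquality.Core using (_≡_; _≗_)
open import Relation.Nullary.Negation.Core using (¬_)

-- [n] = {1,…,n} is encoded by Fin n, with x : Fin n standing for the
-- number label x.  A permutation π of [n] is read as the one-line word
-- π₁⋯πₙ: π ⟨$⟩ʳ p is the entry at position p, and π ⟨$⟩ˡ x is the
-- position of the entry x.
label : ∀ {n} → Fin n → ℕ
label x = suc (toℕ x)

data Cover (s t : ℕ) (x y : Fin (s ℕ.* t)) : Set where
  spine : label x ≤ s ℕ.∸ 1 →
          label y ≡ label x ℕ.+ 1 → Cover s t x y
  tooth : label x ≤ s ℕ.* t ℕ.∸ s →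
          label y ≡ label x ℕ.+ s → Cover s t x y

-- The strict order of K^α_{s,t}.
Comb< : (s t : ℕ) → Fin (s ℕ.* t) → Fin (s ℕ.* t) → Set
Comb< s t = TransClosure (Cover s t)

IsLinearExtension : (s t : ℕ) → Permutation′ (s ℕ.* t) → Set
IsLinearExtension s t π = ∀ x y → Comb< s t x y → π ⟨$⟩ˡ x < π ⟨$⟩ˡ y

Avoids321 : ∀ {n} → Permutation′ n → Set
Avoids321 π = ¬ (∃[ a ] ∃[ b ] ∃[ c ] a < b × b < c ×
                 π ⟨$⟩ʳ b < π ⟨$⟩ʳ a × π ⟨$⟩ʳ c < π ⟨$⟩ʳ b)

IsRightToLeftMin : ∀ {n} → Permutation′ n → Fin n → Set
IsRightToLeftMin π x =
  ∃[ p ] π ⟨$⟩ʳ p ≡ x × (∀ q → p < q → π ⟨$⟩ʳ p < π ⟨$⟩ʳ q)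

-- A k-element set {a₁ < ⋯ < aₖ} is given by its increasing enumeration,
-- so two such sets are equal when their enumerations agree pointwise.
_∈_ : ∀ {k} {A : Set} → A → (Fin k → A) → Set
x ∈ a = ∃[ ℓ ] a ℓ ≡ x

_∉_ : ∀ {k} {A : Set} → A → (Fin k → A) → Set
x ∉ a = ¬ (x ∈ a)

record Ω (s t : ℕ) {k : ℕ} (w : Fin k → Fin (s ℕ.* t)) : Set where
  field
    elem       : Fin k → ℤ
    increasing : elem Preserves _<_ ⟶ ℤ._<_
    lower      : ∀ ℓ → + label (w ℓ) ℤ.- + s ℤ.+ + label ℓ ℤ.≤ elem ℓ
    upper      : ∀ ℓ → elem ℓ ℤ.≤ + label (w ℓ) ℤ.- + 1

record Λ (s t : ℕ) {k : ℕ} (w : Fin k → Fin (s ℕ.* t)) : Set where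
  field
    perm            : Permutation′ (s ℕ.* t)
    linearExtension : IsLinearExtension s t perm
    avoids321       : Avoids321 perm
    minima          : ∀ x → IsRightToLeftMin perm x ⇔ x ∉ w

_≈Ω_ : ∀ {s t k} {w : Fin k → Fin (s ℕ.* t)} → Ω s t w → Ω s t w → Set
I ≈Ω J = Ω.elem I ≗ Ω.elem J

_≈Λ_ : ∀ {s t k} {w : Fin k → Fin (s ℕ.* t)} → Λ s t w → Λ s t w → Set
π ≈Λ ρ = Λ.perm π ≈ Λ.perm ρ

-- π is the word with the entry w ℓ at position i ℓ for every ℓ and the
-- entries outside w in increasing order in the remaining positions.  The
-- existential makes it part of the claim that each integer i ℓ is a
-- position in [n].
record IsPlacement {n k : ℕ} (w : Fin k → Fin n) (i : Fin k → ℤ)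
                   (π : Permutation′ n) : Set where
  field
    placed : ∀ ℓ → ∃[ p ] + label p ≡ i ℓ × π ⟨$⟩ʳ p ≡ w ℓ
    others : ∀ x y → x ∉ w → y ∉ w → x < y → π ⟨$⟩ˡ x < π ⟨$⟩ˡ y

{-# OPTIONS --safe #-}
module Submission where

-- Let A, B be the increasing enumerations of a k-subset of [n] and of its
-- complement, indices and values starting at 0.  Counting the elements below
-- A i gives the rank criterion: B j < A i iff j + i < A i.  Apply it both to
-- the positions (I and its complement) and to the values (W and its
-- complement) of a word merging two increasing subwords: the upper bound on I
-- says exactly that no entry of W is a right-to-left minimum, and the lower
-- bound puts w - s before w.  Conversely, a 321-avoiding word whose
-- non-minima are W merges the increasing words on W and on its complement, so
-- it is determined by the positions of W; for t = 2 the same criterion turns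
-- the linear extension property back into the lower bound.

open import Defs
open import Data.Nat.Base using (ℕ; _+_; _*_; _≤_)
open import Data.Fin.Base using (Fin; _<_)
open import Data.Fin.Permutation using (Permutation′; _≈_)
open import Data.Product.Base using (Σ-syntax; _×_)
open import Function.Structures using (IsInjection; IsBijection)
open import Relation.Binary.Core using (_Preserves_⟶_)
open import Relation.Binary.PropositionalEquality.Core using (_≡_)

open import Data.Empty using (⊥)
open import Data.Fin.Base using (zero; suc; toℕ; fromℕ<; punchOut)
open import Data.Fin.Permutation using (permutation; _⟨$⟩ʳ_; _⟨$⟩ˡ_; inverseˡ; inverseʳ)
open import Data.Fin.Properties
  using (<-cmp; toℕ-injective; toℕ<n; toℕ-fromℕ<; <⇒≢; punchIn-punchOut)
open import Data.Integer.Base as ℤ using (ℤ; -[1+_]; +≤+; -≤+; +<+)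
import Data.Integer.Properties as ℤ
open import Data.Nat.Base as ℕ using (zero; suc; _∸_; z≤n; s≤s; z<s; s<s; s<s⁻¹; s≤s⁻¹)
import Data.Nat.Properties as ℕ
open import Data.Product.Base using (∃-syntax; _,_; proj₁; proj₂)
open import Data.Sum.Base using (_⊎_; inj₁; inj₂; [_,_]′; map₁; map₂)
open import Data.Sum.Properties using (inj₂-injective)
open import Function.Base using (_∘_)
open import Function.Bundles using (_⇔_; mk⇔; Equivalence)
open import Relation.Binary.Construct.Closure.Transitive using ([_]; _∷_)
open import Relation.Binary.Definitions using (tri<; tri≈; tri>)
open import Relation.Binary.PropositionalEquality
  using (_≢_; _≗_; refl; sym; trans; cong; subst; subst₂; module ≡-Reasoning)
open import Relation.Nullary.Negation using (¬_; contradiction)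

-- Increasing enumerations of a subset and of its complement.

increasing⇒reflects : ∀ {k n} (f : Fin k → Fin n) → f Preserves _<_ ⟶ _<_ →
                      ∀ {i j} → f i < f j → i < j
increasing⇒reflects f f↗ {i} {j} fi<fj with <-cmp i j
... | tri< i<j _ _ = i<j
... | tri≈ _ refl _ = contradiction fi<fj (ℕ.<-irrefl refl)
... | tri> _ _ j<i = contradiction (f↗ j<i) (ℕ.<-asym fi<fj)

-- A partition of Fin n into a k-subset and an m-subset, enumerated in
-- increasing order by inl and inr below.
data Shuffle : ℕ → ℕ → ℕ → Set where
  []    : Shuffle 0 0 0
  left  : ∀ {k m n} → Shuffle k m n → Shuffle (suc k) m (suc n)
  right : ∀ {k m n} → Shuffle k m n → Shuffle k (suc m) (suc n)

inl : ∀ {k m n} → Shuffle k m n → Fin k → Fin n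
inl (left S)  zero    = zero
inl (left S)  (suc i) = suc (inl S i)
inl (right S) i       = suc (inl S i)

inr : ∀ {k m n} → Shuffle k m n → Fin m → Fin n
inr (left S)  j       = suc (inr S j)
inr (right S) zero    = zero
inr (right S) (suc j) = suc (inr S j)

-- Serves as case analysis on the block containing `x`: goals are restated at `inl S i` and
-- `inr S j`, where the rank criterion and the rules for `split` apply directly.
shuffle-elim : ∀ {k m n} (S : Shuffle k m n) (R : Fin n → Set) →
               (∀ i → R (inl S i)) → (∀ j → R (inr S j)) → ∀ x → R x
shuffle-elim (left S)  R f g zero    = f zero
shuffle-elim (left S)  R f g (suc x) = shuffle-elim S (R ∘ suc) (f ∘ suc) g x
shuffle-elim (right S) R f g zero    = g zero
shuffle-elim (right S) R f g (suc x) = shuffle-elim S (R ∘ suc) f (g ∘ suc) x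

split : ∀ {k m n} → Shuffle k m n → Fin n → Fin k ⊎ Fin m
split (left S)  zero    = inj₁ zero
split (left S)  (suc x) = map₁ suc (split S x)
split (right S) zero    = inj₂ zero
split (right S) (suc x) = map₂ suc (split S x)

join : ∀ {k m n} → Shuffle k m n → Fin k ⊎ Fin m → Fin n
join S = [ inl S , inr S ]′

split-inl : ∀ {k m n} (S : Shuffle k m n) i → split S (inl S i) ≡ inj₁ i
split-inl (left S)  zero    = refl
split-inl (left S)  (suc i) = cong (map₁ suc) (split-inl S i)
split-inl (right S) i       = cong (map₂ suc) (split-inl S i)

split-inr : ∀ {k m n} (S : Shuffle k m n) j → split S (inr S j) ≡ inj₂ j
split-inr (left S)  j       = cong (map₁ suc) (split-inr S j)
split-inr (right S) zero    = refl
split-inr (right S) (suc j) = cong (map₂ suc) (split-inr S j)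

split-join : ∀ {k m n} (S : Shuffle k m n) u → split S (join S u) ≡ u
split-join S (inj₁ i) = split-inl S i
split-join S (inj₂ j) = split-inr S j

join-split : ∀ {k m n} (S : Shuffle k m n) x → join S (split S x) ≡ x
join-split S = shuffle-elim S (λ x → join S (split S x) ≡ x)
  (λ i → cong (join S) (split-inl S i)) (λ j → cong (join S) (split-inr S j))

inr-injective : ∀ {k m n} (S : Shuffle k m n) {j j′} → inr S j ≡ inr S j′ → j ≡ j′
inr-injective S {j} {j′} eq = inj₂-injective
  (trans (sym (split-inr S j)) (trans (cong (split S) eq) (split-inr S j′)))

inl≢inr : ∀ {k m n} (S : Shuffle k m n) i j → inl S i ≢ inr S j
inl≢inr S i j eq
  with () ← trans (sym (split-inl S i)) (trans (cong (split S) eq) (split-inr S j))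

inr∉inl : ∀ {k m n} (S : Shuffle k m n) j → inr S j ∉ inl S
inr∉inl S j (i , eq) = inl≢inr S i j eq

∉inl⇒∈inr : ∀ {k m n} (S : Shuffle k m n) x → x ∉ inl S → x ∈ inr S
∉inl⇒∈inr S = shuffle-elim S (λ x → x ∉ inl S → x ∈ inr S)
  (λ i i∉ → contradiction (i , refl) i∉) (λ j _ → j , refl)

inl-increasing : ∀ {k m n} (S : Shuffle k m n) → inl S Preserves _<_ ⟶ _<_
inl-increasing (left S)  {zero}  {suc j} _   = z<s
inl-increasing (left S)  {suc i} {suc j} i<j = s<s (inl-increasing S (s<s⁻¹ i<j))
inl-increasing (right S)                 i<j = s<s (inl-increasing S i<j)

inr-increasing : ∀ {k m n} (S : Shuffle k m n) → inr S Preserves _<_ ⟶ _<_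
inr-increasing (left S)                  i<j = s<s (inr-increasing S i<j)
inr-increasing (right S) {zero}  {suc j} _   = z<s
inr-increasing (right S) {suc i} {suc j} i<j = s<s (inr-increasing S (s<s⁻¹ i<j))

-- Ranks: counting the elements below a given one.

inl≥ : ∀ {k m n} (S : Shuffle k m n) i → toℕ i ≤ toℕ (inl S i)
inl≥ (left S)  zero    = z≤n
inl≥ (left S)  (suc i) = s≤s (inl≥ S i)
inl≥ (right S) i       = ℕ.m≤n⇒m≤1+n (inl≥ S i)

inr≥ : ∀ {k m n} (S : Shuffle k m n) j → toℕ j ≤ toℕ (inr S j)
inr≥ (left S)  j       = ℕ.m≤n⇒m≤1+n (inr≥ S j)
inr≥ (right S) zero    = z≤n
inr≥ (right S) (suc j) = s≤s (inr≥ S j)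

-- Below `inl S i` lie `i` elements of its own block and at most all `m` of the other.
inl≤ : ∀ {k m n} (S : Shuffle k m n) i → toℕ (inl S i) ≤ m + toℕ i
inl≤         (left S)  zero    = z≤n
inl≤ {m = m} (left S)  (suc i) rewrite ℕ.+-suc m (toℕ i) = s≤s (inl≤ S i)
inl≤         (right S) i       = s≤s (inl≤ S i)

-- The value of `inl S i` is `i` plus the number of right elements below it, and `inr S j` is one of
-- these exactly when their number exceeds `j`. Peeling off `zero` lowers the value and one of the
-- two indices together.
inr<inl⇒ : ∀ {k m n} (S : Shuffle k m n) i j →
           inr S j < inl S i → toℕ j + toℕ i ℕ.< toℕ (inl S i)
inr<inl⇒ (left S)  (suc i) j lt rewrite ℕ.+-suc (toℕ j) (toℕ i) =
  s<s (inr<inl⇒ S i j (s<s⁻¹ lt))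
inr<inl⇒ (right S) i zero    _  = s≤s (inl≥ S i)
inr<inl⇒ (right S) i (suc j) lt = s<s (inr<inl⇒ S i j (s<s⁻¹ lt))

⇒inr<inl : ∀ {k m n} (S : Shuffle k m n) i j →
           toℕ j + toℕ i ℕ.< toℕ (inl S i) → inr S j < inl S i
⇒inr<inl (left S)  (suc i) j lt rewrite ℕ.+-suc (toℕ j) (toℕ i) =
  s<s (⇒inr<inl S i j (s<s⁻¹ lt))
⇒inr<inl (right S) i zero    _  = z<s
⇒inr<inl (right S) i (suc j) lt = s<s (⇒inr<inl S i j (s<s⁻¹ lt))

inl<inr⇒ : ∀ {k m n} (S : Shuffle k m n) i j →
           inl S i < inr S j → toℕ (inl S i) ≤ toℕ j + toℕ i
inl<inr⇒ S i j lt = ℕ.≮⇒≥ (λ gt → ℕ.<-asym lt (⇒inr<inl S i j gt))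

⇒inl<inr : ∀ {k m n} (S : Shuffle k m n) i j →
           toℕ (inl S i) ≤ toℕ j + toℕ i → inl S i < inr S j
⇒inl<inr S i j le with <-cmp (inl S i) (inr S j)
... | tri< lt _ _ = lt
... | tri≈ _ eq _ = contradiction eq (inl≢inr S i j)
... | tri> _ _ gt = contradiction (inr<inl⇒ S i j gt) (ℕ.≤⇒≯ le)

-- Until the first left element appears all elements are right ones, so nothing separates rank from
-- value.
inr-initial : ∀ {k m n} (S : Shuffle (suc k) m n) j →
              inr S j < inl S zero → toℕ (inr S j) ≡ toℕ j
inr-initial (right S) zero    _  = refl
inr-initial (right S) (suc j) lt = cong suc (inr-initial S j (s<s⁻¹ lt))

-- Recovering a shuffle from an increasing function.

shuffle-size : ∀ {k m n} → Shuffle k m n → k + m ≡ n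
shuffle-size []                    = refl
shuffle-size (left S)              = cong suc (shuffle-size S)
shuffle-size {k} {suc m} (right S) = trans (ℕ.+-suc k m) (cong suc (shuffle-size S))

shuffle-size-unique : ∀ {k m m′ n} → Shuffle k m n → Shuffle k m′ n → m ≡ m′
shuffle-size-unique {k} {m} {m′} S T =
  ℕ.+-cancelˡ-≡ k m m′ (trans (shuffle-size S) (sym (shuffle-size T)))

-- `punchIn zero` reduces to `suc`, so `punchOut` at `zero` acts as a predecessor.
unsuc : ∀ {k n} (f : Fin k → Fin (suc n)) → (∀ i → zero {n} < f i) →
        ∃[ g ] (∀ i → suc (g i) ≡ f i)
unsuc f 0<f = (λ i → punchOut (<⇒≢ (0<f i))) , (λ i → punchIn-punchOut (<⇒≢ (0<f i)))

unsuc-increasing : ∀ {k n} {f : Fin k → Fin (suc n)} {g : Fin k → Fin n} →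
                   (∀ i → suc (g i) ≡ f i) →
                   f Preserves _<_ ⟶ _<_ → g Preserves _<_ ⟶ _<_
unsuc-increasing eq f↗ {i} {j} i<j =
  s<s⁻¹ (subst₂ _<_ (sym (eq i)) (sym (eq j)) (f↗ i<j))

-- Walks through `Fin n` from the smallest element up, asking whether each is the next value of `f`.
-- By monotonicity only the first value can be `zero`, and the others can be lowered. The complement
-- size `m` is found along the way.
toShuffle : ∀ {n k} (f : Fin k → Fin n) → f Preserves _<_ ⟶ _<_ →
            ∃[ m ] Σ[ S ∈ Shuffle k m n ] inl S ≗ f
toShuffle {zero}  {zero}  f f↗ = 0 , [] , λ ()
toShuffle {zero}  {suc k} f f↗ with () ← f zero
toShuffle {suc n} {zero}  f f↗ with toShuffle {n} (λ ()) (λ { {()} })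
... | m , S , _ = suc m , right S , λ ()
toShuffle {suc n} {suc k} f f↗ with f zero in f0
... | zero with unsuc (f ∘ suc) (λ i → subst (_< f (suc i)) f0 (f↗ z<s))
...   | g , eq with toShuffle g (unsuc-increasing eq (f↗ ∘ s<s))
...     | m , S , S≗g = m , left S , λ where
            zero    → sym f0
            (suc i) → trans (cong suc (S≗g i)) (eq i)
toShuffle {suc n} {suc k} f f↗ | suc x with unsuc f 0<f
  where
  0<f : ∀ i → zero {n} < f i
  0<f zero    rewrite f0 = z<s
  0<f (suc i) = ℕ.≤-<-trans z≤n (f↗ {zero} {suc i} z<s)
... | g , eq with toShuffle g (unsuc-increasing eq f↗)
...   | m , S , S≗g = suc m , right S , λ i → trans (cong suc (S≗g i)) (eq i)

inl-full : ∀ {n} (S : Shuffle n 0 n) i → inl S i ≡ i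
inl-full (left S) zero    = refl
inl-full (left S) (suc i) = cong suc (inl-full S i)

-- By counting, the image has a complement of size zero, and a shuffle with empty right block
-- enumerates everything in order.
increasing-endo : ∀ {n} (f : Fin n → Fin n) → f Preserves _<_ ⟶ _<_ → ∀ i → f i ≡ i
increasing-endo {n} f f↗ i with toShuffle f f↗
... | m , S , S≗f
  with refl ← ℕ.+-cancelˡ-≡ n m 0 (trans (shuffle-size S) (sym (ℕ.+-identityʳ n))) =
  trans (sym (S≗f i)) (inl-full S i)

-- Words that merge two increasing subwords.

permutation-injective : ∀ {n} (π : Permutation′ n) {p q} → π ⟨$⟩ʳ p ≡ π ⟨$⟩ʳ q → p ≡ q
permutation-injective π eq = trans (sym (inverseˡ π)) (trans (cong (π ⟨$⟩ˡ_) eq) (inverseˡ π))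

permutation⁻¹-injective : ∀ {n} (π : Permutation′ n) {x y} → π ⟨$⟩ˡ x ≡ π ⟨$⟩ˡ y → x ≡ y
permutation⁻¹-injective π eq = trans (sym (inverseʳ π)) (trans (cong (π ⟨$⟩ʳ_) eq) (inverseʳ π))

-- `P` partitions the positions and `Q` the values; each block of positions receives the matching
-- block of values in increasing order.
reorder : ∀ {k m n} → Shuffle k m n → Shuffle k m n → Permutation′ n
reorder P Q = permutation (join Q ∘ split P) (join P ∘ split Q)
  (λ x → trans (cong (join Q) (split-join P (split Q x))) (join-split Q x))
  (λ x → trans (cong (join P) (split-join Q (split P x))) (join-split P x))

module _ {k m n : ℕ} (P Q : Shuffle k m n) where

  reorder-inl : ∀ i → reorder P Q ⟨$⟩ʳ inl P i ≡ inl Q i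
  reorder-inl i = cong (join Q) (split-inl P i)

  reorder-inr : ∀ j → reorder P Q ⟨$⟩ʳ inr P j ≡ inr Q j
  reorder-inr j = cong (join Q) (split-inr P j)

  reorder⁻¹-inl : ∀ i → reorder P Q ⟨$⟩ˡ inl Q i ≡ inl P i
  reorder⁻¹-inl i = cong (join P) (split-inl Q i)

  reorder⁻¹-inr : ∀ j → reorder P Q ⟨$⟩ˡ inr Q j ≡ inr P j
  reorder⁻¹-inr j = cong (join P) (split-inr Q j)

  reorder-inl< : ∀ i i′ → inl P i < inl P i′ →
                 reorder P Q ⟨$⟩ʳ inl P i < reorder P Q ⟨$⟩ʳ inl P i′
  reorder-inl< i i′ lt = subst₂ _<_ (sym (reorder-inl i)) (sym (reorder-inl i′))
    (inl-increasing Q (increasing⇒reflects (inl P) (inl-increasing P) lt))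

  reorder-inr< : ∀ j j′ → inr P j < inr P j′ →
                 reorder P Q ⟨$⟩ʳ inr P j < reorder P Q ⟨$⟩ʳ inr P j′
  reorder-inr< j j′ lt = subst₂ _<_ (sym (reorder-inr j)) (sym (reorder-inr j′))
    (inr-increasing Q (increasing⇒reflects (inr P) (inr-increasing P) lt))

  -- Two of any three positions belong to the same increasing subword.
  reorder-avoids321 : Avoids321 (reorder P Q)
  reorder-avoids321 (a , b , c , a<b , b<c , πb<πa , πc<πb) =
    shuffle-elim P A
      (λ i → shuffle-elim P (B (inl P i))
        (λ i′ _ lt _ gt _ → ℕ.<-asym gt (reorder-inl< i i′ lt))
        (λ j → shuffle-elim P (C (inl P i) (inr P j))
          (λ i′ lt lt′ gt gt′ → ℕ.<-asym (ℕ.<-trans gt′ gt) (reorder-inl< i i′ (ℕ.<-trans lt lt′)))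
          (λ j′ _ lt _ gt → ℕ.<-asym gt (reorder-inr< j j′ lt))))
      (λ j → shuffle-elim P (B (inr P j))
        (λ i → shuffle-elim P (C (inr P j) (inl P i))
          (λ i′ _ lt _ gt → ℕ.<-asym gt (reorder-inl< i i′ lt))
          (λ j′ lt lt′ gt gt′ → ℕ.<-asym (ℕ.<-trans gt′ gt) (reorder-inr< j j′ (ℕ.<-trans lt lt′))))
        (λ j′ _ lt _ gt _ → ℕ.<-asym gt (reorder-inr< j j′ lt)))
      a b c a<b b<c πb<πa πc<πb
    where
    π = reorder P Q
    C : Fin n → Fin n → Fin n → Set
    C a b c = a < b → b < c → π ⟨$⟩ʳ b < π ⟨$⟩ʳ a → π ⟨$⟩ʳ c < π ⟨$⟩ʳ b → ⊥
    B : Fin n → Fin n → Set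
    B a b = ∀ c → C a b c
    A : Fin n → Set
    A a = ∀ b → B a b

  reorder-others : ∀ x y → x ∉ inl Q → y ∉ inl Q → x < y →
                   reorder P Q ⟨$⟩ˡ x < reorder P Q ⟨$⟩ˡ y
  reorder-others x y x∉ y∉ x<y
    with ∉inl⇒∈inr Q x x∉ | ∉inl⇒∈inr Q y y∉
  ... | j , refl | j′ , refl = subst₂ _<_ (sym (reorder⁻¹-inr j)) (sym (reorder⁻¹-inr j′))
    (inr-increasing P (increasing⇒reflects (inr Q) (inr-increasing Q) x<y))

  -- The entries at the right positions define an increasing map `f` from `Fin m` to itself, which
  -- must be the identity.
  reorder-unique : (π : Permutation′ n) → (∀ i → π ⟨$⟩ʳ inl P i ≡ inl Q i) →
                   (∀ x y → x ∉ inl Q → y ∉ inl Q → x < y → π ⟨$⟩ˡ x < π ⟨$⟩ˡ y) →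
                   π ≈ reorder P Q
  reorder-unique π π-inl π-others = shuffle-elim P (λ p → π ⟨$⟩ʳ p ≡ reorder P Q ⟨$⟩ʳ p)
    (λ i → trans (π-inl i) (sym (reorder-inl i)))
    (λ j → trans (sym (proj₂ (π-inr j)))
             (trans (cong (inr Q) (increasing-endo f f↗ j)) (sym (reorder-inr j))))
    where
    -- The left positions already carry all the left values, so by injectivity none remains for
    -- `inr P j`.
    π-inr : ∀ j → (π ⟨$⟩ʳ inr P j) ∈ inr Q
    π-inr j = ∉inl⇒∈inr Q _ (λ { (i , eq) →
      inl≢inr P i j (permutation-injective π (trans (π-inl i) eq)) })
    f : Fin m → Fin m
    f j = proj₁ (π-inr j)
    π⁻¹-f : ∀ j → π ⟨$⟩ˡ inr Q (f j) ≡ inr P j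
    π⁻¹-f j = trans (cong (π ⟨$⟩ˡ_) (proj₂ (π-inr j))) (inverseˡ π)
    f↗ : f Preserves _<_ ⟶ _<_
    f↗ {j} {j′} j<j′ with <-cmp (f j) (f j′)
    ... | tri< lt _ _ = lt
    ... | tri≈ _ eq _ = contradiction
      (inr-injective P (trans (sym (π⁻¹-f j))
        (trans (cong (λ l → π ⟨$⟩ˡ inr Q l) eq) (π⁻¹-f j′)))) (<⇒≢ j<j′)
    -- An inversion of `f` would make `π-others` put position `inr P j′` before `inr P j`.
    ... | tri> _ _ gt = contradiction
      (subst₂ _<_ (π⁻¹-f j′) (π⁻¹-f j)
        (π-others _ _ (inr∉inl Q (f j′)) (inr∉inl Q (f j)) (inr-increasing Q gt)))
      (ℕ.<-asym (inr-increasing P j<j′))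

  -- A left entry is not a minimum because the first right position after it carries a smaller
  -- entry. A right entry is one because a left entry at a later position passes the rank test at
  -- `P`, hence also at the larger value in `Q`, while later right entries are larger anyway.
  reorder-minima : (∀ i → inl P i < inl Q i) →
                   ∀ x → IsRightToLeftMin (reorder P Q) x ⇔ x ∉ inl Q
  reorder-minima P<Q x = mk⇔ to from
    where
    π = reorder P Q
    to : IsRightToLeftMin π x → x ∉ inl Q
    to (p , πp≡x , p-min) (i , refl) = ℕ.<-asym
      (subst₂ _<_ πp≡x (reorder-inr j)
        (p-min (inr P j) (subst (_< inr P j) p≡ (⇒inl<inr P i j (ℕ.≤-reflexive (sym j+i))))))
      (⇒inr<inl Q i j (subst (ℕ._< toℕ (inl Q i)) (sym j+i) (P<Q i)))
      where
      p≡ : inl P i ≡ p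
      p≡ = trans (sym (reorder⁻¹-inl i)) (trans (cong (π ⟨$⟩ˡ_) (sym πp≡x)) (inverseˡ π))
      -- The difference counts the right positions before `inl P i`, so it is the index of the first
      -- one after it. That one exists because `inl P i < inl Q i ≤ m + i`.
      gap<m : toℕ (inl P i) ∸ toℕ i ℕ.< m
      gap<m = ℕ.+-cancelʳ-< (toℕ i) _ m (subst (ℕ._< m + toℕ i)
        (sym (ℕ.m∸n+n≡m (inl≥ P i))) (ℕ.<-≤-trans (P<Q i) (inl≤ Q i)))
      j : Fin m
      j = fromℕ< gap<m
      j+i : toℕ j + toℕ i ≡ toℕ (inl P i)
      j+i = trans (cong (_+ toℕ i) (toℕ-fromℕ< gap<m)) (ℕ.m∸n+n≡m (inl≥ P i))
    from : x ∉ inl Q → IsRightToLeftMin π x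
    from x∉ with ∉inl⇒∈inr Q x x∉
    ... | j , refl = inr P j , reorder-inr j , shuffle-elim P
      (λ q → inr P j < q → π ⟨$⟩ʳ inr P j < π ⟨$⟩ʳ q)
      (λ i lt → subst₂ _<_ (sym (reorder-inr j)) (sym (reorder-inl i))
        (⇒inr<inl Q i j (ℕ.<-trans (inr<inl⇒ P i j lt) (P<Q i))))
      (λ j′ → reorder-inr< j j′)

  -- If `inl P i` were at least `inl Q i`, the rank criterion would make every right entry after it
  -- larger; later left entries are larger too, so it would be a minimum.
  nonminimum⇒displaced : ∀ i → ¬ IsRightToLeftMin (reorder P Q) (inl Q i) → inl P i < inl Q i
  nonminimum⇒displaced i ¬min = ℕ.≰⇒> λ Q≤P →
    ¬min (inl P i , reorder-inl i , shuffle-elim P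
      (λ q → inl P i < q → reorder P Q ⟨$⟩ʳ inl P i < reorder P Q ⟨$⟩ʳ q)
      (λ i′ → reorder-inl< i i′)
      (λ j lt → subst₂ _<_ (sym (reorder-inl i)) (sym (reorder-inr j))
        (⇒inl<inr Q i j (ℕ.≤-trans Q≤P (inl<inr⇒ P i j lt)))))

-- Right-to-left minima in 321-avoiding words.

≈⇒≈⁻¹ : ∀ {n} {π ρ : Permutation′ n} → π ≈ ρ → ∀ x → π ⟨$⟩ˡ x ≡ ρ ⟨$⟩ˡ x
≈⇒≈⁻¹ {π = π} {ρ} π≈ρ x =
  permutation-injective π (trans (inverseʳ π) (sym (trans (π≈ρ _) (inverseʳ ρ))))

minimum-resp-≈ : ∀ {n} {π ρ : Permutation′ n} → π ≈ ρ →
                 ∀ {x} → IsRightToLeftMin π x → IsRightToLeftMin ρ x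
minimum-resp-≈ π≈ρ (p , πp≡x , p-min) =
  p , trans (sym (π≈ρ p)) πp≡x , λ q lt → subst₂ _<_ (π≈ρ p) (π≈ρ q) (p-min q lt)

-- If the larger `y` stood before `x`, any smaller entry after `x` would complete a 321 pattern, so
-- `x` would be a minimum.
nonminimum-before : ∀ {n} (π : Permutation′ n) → Avoids321 π →
                    ∀ {x y} → ¬ IsRightToLeftMin π x → x < y → π ⟨$⟩ˡ x < π ⟨$⟩ˡ y
nonminimum-before π avoids {x} {y} ¬min x<y with <-cmp (π ⟨$⟩ˡ x) (π ⟨$⟩ˡ y)
... | tri< lt _ _ = lt
... | tri≈ _ eq _ = contradiction (permutation⁻¹-injective π eq) (<⇒≢ x<y)
... | tri> _ _ gt = contradiction (π ⟨$⟩ˡ x , inverseʳ π , min) ¬min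
  where
  min : ∀ q → π ⟨$⟩ˡ x < q → π ⟨$⟩ʳ (π ⟨$⟩ˡ x) < π ⟨$⟩ʳ q
  min q lt with <-cmp (π ⟨$⟩ʳ (π ⟨$⟩ˡ x)) (π ⟨$⟩ʳ q)
  ... | tri< πx<πq _ _ = πx<πq
  ... | tri≈ _ eq _ = contradiction (permutation-injective π eq) (<⇒≢ lt)
  ... | tri> _ _ πq<πx = contradiction
    (π ⟨$⟩ˡ y , π ⟨$⟩ˡ x , q , gt , lt ,
      subst₂ _<_ (sym (inverseʳ π)) (sym (inverseʳ π)) x<y , πq<πx) avoids

before-minimum : ∀ {n} (π : Permutation′ n) {x y} →
                 IsRightToLeftMin π y → x < y → π ⟨$⟩ˡ x < π ⟨$⟩ˡ y
before-minimum π {x} {y} (p , refl , p-min) x<y with <-cmp (π ⟨$⟩ˡ x) p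
... | tri< lt _ _ = subst (π ⟨$⟩ˡ x <_) (sym (inverseˡ π)) lt
... | tri≈ _ eq _ = contradiction (trans (sym (inverseʳ π)) (cong (π ⟨$⟩ʳ_) eq)) (<⇒≢ x<y)
... | tri> _ _ gt = contradiction (subst (π ⟨$⟩ʳ p <_) (inverseʳ π) (p-min _ gt)) (ℕ.<-asym x<y)

-- The comb order on merged words.

label-injective : ∀ {n} {x y : Fin n} → label x ≡ label y → x ≡ y
label-injective = toℕ-injective ∘ ℕ.suc-injective

Cover⇒< : ∀ {s t x y} → 1 ≤ s → Cover s t x y → x < y
Cover⇒< {x = x} 1≤s (spine _ eq) =
  subst (toℕ x ℕ.<_) (sym (ℕ.suc-injective eq)) (ℕ.m<m+n (toℕ x) z<s)
Cover⇒< {x = x} 1≤s (tooth _ eq) =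
  subst (toℕ x ℕ.<_) (sym (ℕ.suc-injective eq)) (ℕ.m<m+n (toℕ x) 1≤s)

module _ {s t k m : ℕ} (1≤s : 1 ≤ s) (P Q : Shuffle k m (s * t))
         (s≤Q : ∀ i → s ≤ toℕ (inl Q i)) where

  -- Covers inside a block survive because each block stays in order. A left element below a right
  -- one stays before it, since lowering its position from `inl Q i` to `inl P i` preserves the rank
  -- test. A right element below a left one needs the lower bound.
  reorder-linearExtension :
    (∀ i → inl P i < inl Q i) →
    (∀ i → toℕ (inl Q i) + suc (toℕ i) ≤ toℕ (inl P i) + s) →
    IsLinearExtension s t (reorder P Q)
  reorder-linearExtension P<Q Q≤P x y [ c ] = shuffle-elim Q (λ x → ∀ y → R x y)
      (λ i → shuffle-elim Q (R (inl Q i))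
        (λ i′ c → subst₂ _<_ (sym (reorder⁻¹-inl P Q i)) (sym (reorder⁻¹-inl P Q i′))
          (inl-increasing P (increasing⇒reflects (inl Q) (inl-increasing Q) (Cover⇒< 1≤s c))))
        (λ j c → subst₂ _<_ (sym (reorder⁻¹-inl P Q i)) (sym (reorder⁻¹-inr P Q j))
          (⇒inl<inr P i j (ℕ.≤-trans (ℕ.<⇒≤ (P<Q i)) (inl<inr⇒ Q i j (Cover⇒< 1≤s c))))))
      (λ j → shuffle-elim Q (R (inr Q j))
        (λ i c → subst₂ _<_ (sym (reorder⁻¹-inr P Q j)) (sym (reorder⁻¹-inl P Q i))
          (⇒inr<inl P i j (tooth-bound i j c)))
        (λ j′ c → subst₂ _<_ (sym (reorder⁻¹-inr P Q j)) (sym (reorder⁻¹-inr P Q j′))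
          (inr-increasing P (increasing⇒reflects (inr Q) (inr-increasing Q) (Cover⇒< 1≤s c)))))
      x y c
    where
    R : Fin (s * t) → Fin (s * t) → Set
    R x y = Cover s t x y → reorder P Q ⟨$⟩ˡ x < reorder P Q ⟨$⟩ˡ y
    open ℕ.≤-Reasoning
    -- The top of a spine cover has label at most `s`, too small for a left value. For a tooth,
    -- `inl Q i` is `inr Q j + s`, and `j ≤ inr Q j` lets `Q≤P` yield the rank test at `P`.
    tooth-bound : ∀ i j → Cover s t (inr Q j) (inl Q i) →
                  toℕ j + toℕ i ℕ.< toℕ (inl P i)
    tooth-bound i j (spine le eq) = contradiction (s≤Q i) (ℕ.<⇒≱ (begin
      label (inl Q i)     ≡⟨ eq ⟩
      label (inr Q j) + 1 ≤⟨ ℕ.+-monoˡ-≤ 1 le ⟩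
      s ∸ 1 + 1           ≡⟨ ℕ.m∸n+n≡m 1≤s ⟩
      s                   ∎))
    tooth-bound i j (tooth _ eq) = ℕ.+-cancelʳ-≤ s _ _ (begin
      suc (toℕ j + toℕ i) + s            ≡⟨ cong (_+ s) (sym (ℕ.+-suc (toℕ j) (toℕ i))) ⟩
      toℕ j + suc (toℕ i) + s            ≤⟨ ℕ.+-monoˡ-≤ s (ℕ.+-monoˡ-≤ (suc (toℕ i)) (inr≥ Q j)) ⟩
      toℕ (inr Q j) + suc (toℕ i) + s    ≡⟨ ℕ.+-assoc (toℕ (inr Q j)) _ s ⟩
      toℕ (inr Q j) + (suc (toℕ i) + s)  ≡⟨ cong (toℕ (inr Q j) +_) (ℕ.+-comm _ s) ⟩
      toℕ (inr Q j) + (s + suc (toℕ i))  ≡⟨ sym (ℕ.+-assoc (toℕ (inr Q j)) s _) ⟩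
      toℕ (inr Q j) + s + suc (toℕ i)    ≡⟨ cong (_+ suc (toℕ i)) (sym (ℕ.suc-injective eq)) ⟩
      toℕ (inl Q i) + suc (toℕ i)        ≤⟨ Q≤P i ⟩
      toℕ (inl P i) + s                  ∎)
  reorder-linearExtension P<Q Q≤P x y (c ∷ cs) =
    ℕ.<-trans (reorder-linearExtension P<Q Q≤P x _ [ c ])
              (reorder-linearExtension P<Q Q≤P _ y cs)

-- For t = 2 the entry inl Q i covers a spine entry, and all the spine entries
-- lie below inl Q, so the rank of that entry in inr Q is its own value.
linearExtension⇒lower : ∀ {s k m} (P Q : Shuffle k m (s * 2)) →
  (∀ i → s ≤ toℕ (inl Q i)) → IsLinearExtension s 2 (reorder P Q) →
  ∀ i → toℕ (inl Q i) + suc (toℕ i) ≤ toℕ (inl P i) + s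
linearExtension⇒lower {s} {suc k} {m} P Q s≤Q ext i = bound (∉inl⇒∈inr Q x x∉)
  where
  open ℕ.≤-Reasoning
  s≤v : s ≤ toℕ (inl Q i)
  s≤v = s≤Q i
  v<n : toℕ (inl Q i) ∸ s ℕ.< s * 2
  v<n = ℕ.≤-<-trans (ℕ.m∸n≤m _ s) (toℕ<n (inl Q i))
  x : Fin (s * 2)
  x = fromℕ< v<n
  x≡v∸s : toℕ x ≡ toℕ (inl Q i) ∸ s
  x≡v∸s = toℕ-fromℕ< v<n
  x<s*2∸s : toℕ x ℕ.< s * 2 ∸ s
  x<s*2∸s = subst (ℕ._< s * 2 ∸ s) (sym x≡v∸s) (ℕ.∸-monoˡ-< (toℕ<n (inl Q i)) s≤v)
  -- Here t = 2 enters: `s * 2 ∸ s` is `s`, so `x` lies on the spine and hence outside the left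
  -- block.
  x<s : toℕ x ℕ.< s
  x<s = subst (toℕ x ℕ.<_) s*2∸s≡s x<s*2∸s
    where
    s*2∸s≡s : s * 2 ∸ s ≡ s
    s*2∸s≡s = trans (cong (_∸ s) (trans (ℕ.*-suc s 1) (cong (s +_) (ℕ.*-identityʳ s))))
                    (ℕ.m+n∸m≡n s s)
  x∉ : x ∉ inl Q
  x∉ (i′ , eq) = ℕ.<⇒≱ x<s (subst (λ y → s ≤ toℕ y) eq (s≤Q i′))
  v≡x+s : toℕ (inl Q i) ≡ toℕ x + s
  v≡x+s = sym (trans (cong (_+ s) x≡v∸s) (ℕ.m∸n+n≡m s≤v))
  bound : x ∈ inr Q → toℕ (inl Q i) + suc (toℕ i) ≤ toℕ (inl P i) + s
  bound (j , eq) = begin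
    toℕ (inl Q i) + suc (toℕ i) ≡⟨ cong (_+ suc (toℕ i)) v≡x+s ⟩
    toℕ x + s + suc (toℕ i)     ≡⟨ cong (λ l → l + s + suc (toℕ i)) x≡j ⟩
    toℕ j + s + suc (toℕ i)     ≡⟨ ℕ.+-assoc (toℕ j) s _ ⟩
    toℕ j + (s + suc (toℕ i))   ≡⟨ cong (toℕ j +_) (ℕ.+-comm s _) ⟩
    toℕ j + (suc (toℕ i) + s)   ≡⟨ sym (ℕ.+-assoc (toℕ j) _ s) ⟩
    toℕ j + suc (toℕ i) + s     ≡⟨ cong (_+ s) (ℕ.+-suc (toℕ j) (toℕ i)) ⟩
    suc (toℕ j + toℕ i) + s     ≤⟨ ℕ.+-monoˡ-≤ s (inr<inl⇒ P i j P-before) ⟩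
    toℕ (inl P i) + s           ∎
    where
    x≡j : toℕ x ≡ toℕ j
    x≡j = trans (cong toℕ (sym eq)) (inr-initial Q j
      (ℕ.<-≤-trans (subst (λ y → toℕ y ℕ.< s) (sym eq) x<s) (s≤Q zero)))
    P-before : inr P j < inl P i
    P-before = subst₂ _<_
      (trans (cong (reorder P Q ⟨$⟩ˡ_) (sym eq)) (reorder⁻¹-inr P Q j)) (reorder⁻¹-inl P Q i)
      (ext x (inl Q i) [ tooth x<s*2∸s (cong suc v≡x+s) ])

linearExtension-resp-≈ : ∀ {s t} {π ρ : Permutation′ (s * t)} → π ≈ ρ →
                         IsLinearExtension s t π → IsLinearExtension s t ρ
linearExtension-resp-≈ {π = π} {ρ} π≈ρ ext x y x<y =
  subst₂ _<_ (≈⇒≈⁻¹ {π = π} {ρ} π≈ρ x) (≈⇒≈⁻¹ {π = π} {ρ} π≈ρ y) (ext x y x<y)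

-- Fixing the complement size to that of `Q` indexes both right blocks by the same `Fin m`, as
-- `reorder` requires.
toShuffleOf : ∀ {k m n} → Shuffle k m n → (f : Fin k → Fin n) → f Preserves _<_ ⟶ _<_ →
              Σ[ P ∈ Shuffle k m n ] inl P ≗ f
toShuffleOf Q f f↗ with toShuffle f f↗
... | _ , P , P≗f with refl ← shuffle-size-unique P Q = P , P≗f

-- Translating integer bounds into bounds on naturals.

module _ (a c s : ℕ) where

  private
    cancel-s : (ℤ.+ a ℤ.- ℤ.+ s ℤ.+ ℤ.+ c) ℤ.+ ℤ.+ s ≡ ℤ.+ (a + c)
    cancel-s = begin
      (ℤ.+ a ℤ.- ℤ.+ s ℤ.+ ℤ.+ c) ℤ.+ ℤ.+ s
        ≡⟨ ℤ.+-assoc (ℤ.+ a ℤ.- ℤ.+ s) (ℤ.+ c) (ℤ.+ s) ⟩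
      (ℤ.+ a ℤ.- ℤ.+ s) ℤ.+ (ℤ.+ c ℤ.+ ℤ.+ s)
        ≡⟨ cong (λ z → ℤ.+ a ℤ.- ℤ.+ s ℤ.+ z) (ℤ.+-comm (ℤ.+ c) (ℤ.+ s)) ⟩
      (ℤ.+ a ℤ.- ℤ.+ s) ℤ.+ (ℤ.+ s ℤ.+ ℤ.+ c)
        ≡⟨ sym (ℤ.+-assoc (ℤ.+ a ℤ.- ℤ.+ s) (ℤ.+ s) (ℤ.+ c)) ⟩
      (ℤ.+ a ℤ.- ℤ.+ s) ℤ.+ ℤ.+ s ℤ.+ ℤ.+ c
        ≡⟨ cong (ℤ._+ ℤ.+ c) (ℤ.+-assoc (ℤ.+ a) (ℤ.- ℤ.+ s) (ℤ.+ s)) ⟩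
      ℤ.+ a ℤ.+ (ℤ.- ℤ.+ s ℤ.+ ℤ.+ s) ℤ.+ ℤ.+ c
        ≡⟨ cong (λ z → ℤ.+ a ℤ.+ z ℤ.+ ℤ.+ c) (ℤ.+-inverseˡ (ℤ.+ s)) ⟩
      ℤ.+ a ℤ.+ ℤ.+ 0 ℤ.+ ℤ.+ c
        ≡⟨ cong (ℤ._+ ℤ.+ c) (ℤ.+-identityʳ (ℤ.+ a)) ⟩
      ℤ.+ (a + c) ∎
      where open ≡-Reasoning

  -- Moving `s` to the other side removes the subtraction.
  lower⇒ : ∀ {e} → ℤ.+ a ℤ.- ℤ.+ s ℤ.+ ℤ.+ c ℤ.≤ ℤ.+ e → a + c ≤ e + s
  lower⇒ le = ℤ.drop‿+≤+ (subst (ℤ._≤ _) cancel-s (ℤ.+-monoˡ-≤ (ℤ.+ s) le))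

  ⇒lower : ∀ {e} → a + c ≤ e + s → ℤ.+ a ℤ.- ℤ.+ s ℤ.+ ℤ.+ c ℤ.≤ ℤ.+ e
  ⇒lower {e} le = ℤ.≤-trans
    (ℤ.≤-reflexive (sym (trans (cong (ℤ._- ℤ.+ s) (sym cancel-s)) (uncancel _))))
    (ℤ.≤-trans (ℤ.+-monoˡ-≤ (ℤ.- ℤ.+ s) (+≤+ le)) (ℤ.≤-reflexive (uncancel (ℤ.+ e))))
    where
    uncancel : ∀ z → z ℤ.+ ℤ.+ s ℤ.- ℤ.+ s ≡ z
    uncancel z = trans (ℤ.+-assoc z (ℤ.+ s) (ℤ.- ℤ.+ s))
      (trans (cong (λ y → z ℤ.+ y) (ℤ.+-inverseʳ (ℤ.+ s))) (ℤ.+-identityʳ z))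

  -- Since `s < a`, the lower bound is itself positive, so `z` can be the label of a position.
  lower⇒positive : s ℕ.< a → ∀ {z} → ℤ.+ a ℤ.- ℤ.+ s ℤ.+ ℤ.+ c ℤ.≤ z →
                   ∃[ e ] ℤ.+ suc e ≡ z
  lower⇒positive s<a {ℤ.+ suc e} _  = e , refl
  lower⇒positive s<a {ℤ.+ zero}  le =
    contradiction (ℕ.<-≤-trans s<a (ℕ.m≤m+n a c)) (ℕ.≤⇒≯ (lower⇒ le))
  lower⇒positive s<a { -[1+ _ ]} le =
    contradiction (ℕ.<-≤-trans s<a (ℕ.m≤m+n a c)) (ℕ.≤⇒≯ (lower⇒ (ℤ.≤-trans le -≤+)))

-- The word determined by an element of `Ω`.

<label⇒≤toℕ : ∀ {n} s {x : Fin n} → s + 1 ≤ label x → s ≤ toℕ x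
<label⇒≤toℕ s {x} s<x = s≤s⁻¹ (subst (_≤ label x) (ℕ.+-comm s 1) s<x)

module _ {s t k : ℕ} {w : Fin k → Fin (s * t)} (s<w : ∀ ℓ → s + 1 ≤ label (w ℓ)) where

  private
    s≤w : ∀ ℓ → s ≤ toℕ (w ℓ)
    s≤w ℓ = <label⇒≤toℕ s (s<w ℓ)

  module _ (I : Ω s t w) where
    open Ω I

    -- The lower bound makes the integer positive, and the upper bound keeps it below `w ℓ`, hence
    -- within range.
    position-exists : ∀ ℓ → ∃[ p ] ℤ.+ label p ≡ elem ℓ
    position-exists ℓ
      with lower⇒positive (label (w ℓ)) (label ℓ) s (s≤s (s≤w ℓ)) (lower ℓ)
    ... | e , eq = fromℕ< e<n , trans (cong (λ a → ℤ.+ suc a) (toℕ-fromℕ< e<n)) eq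
      where
      e<n : e ℕ.< s * t
      -- The integer is `suc e` and `label (w ℓ)` minus one reduces to `toℕ (w ℓ)`, so the weak
      -- upper bound reads `e < toℕ (w ℓ)`.
      e<n = ℕ.<-trans (ℤ.drop‿+≤+ (subst (ℤ._≤ _) (sym eq) (upper ℓ))) (toℕ<n (w ℓ))

    position : Fin k → Fin (s * t)
    position ℓ = proj₁ (position-exists ℓ)

    position-elem : ∀ ℓ → ℤ.+ label (position ℓ) ≡ elem ℓ
    position-elem ℓ = proj₂ (position-exists ℓ)

    position-increasing : position Preserves _<_ ⟶ _<_
    position-increasing {i} {j} i<j = s<s⁻¹ (ℤ.drop‿+<+
      (subst₂ ℤ._<_ (sym (position-elem i)) (sym (position-elem j)) (increasing i<j)))

    position-lower : ∀ ℓ → toℕ (w ℓ) + suc (toℕ ℓ) ≤ toℕ (position ℓ) + s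
    position-lower ℓ = s≤s⁻¹ (lower⇒ (label (w ℓ)) (label ℓ) s
      (subst (_ ℤ.≤_) (sym (position-elem ℓ)) (lower ℓ)))

    position-upper : ∀ ℓ → position ℓ < w ℓ
    position-upper ℓ = ℤ.drop‿+≤+ (subst (ℤ._≤ _) (sym (position-elem ℓ)) (upper ℓ))

  -- The word is `reorder P Q`, with `inl P` enumerating the positions in I and `inl Q` the values
  -- in W. Uniqueness is bundled in because congruence and surjectivity of the map both rest on it.
  placement-exists : w Preserves _<_ ⟶ _<_ → 1 ≤ s → (I : Ω s t w) → Σ[ ρ ∈ Λ s t w ]
    (IsPlacement w (Ω.elem I) (Λ.perm ρ) ×
     (∀ π → IsPlacement w (Ω.elem I) π → π ≈ Λ.perm ρ))
  placement-exists w↗ 1≤s I with toShuffle w w↗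
  ... | m , Q , Q≗w with toShuffleOf Q (position I) (position-increasing I)
  ...   | P , P≗pos = ρ , placement , unique
    where
    toQ : ∀ {x} → x ∉ w → x ∉ inl Q
    toQ x∉ (i , eq) = x∉ (i , trans (sym (Q≗w i)) eq)
    fromQ : ∀ {x} → x ∉ inl Q → x ∉ w
    fromQ x∉ (i , eq) = x∉ (i , trans (Q≗w i) eq)
    P<Q : ∀ i → inl P i < inl Q i
    P<Q i = subst₂ _<_ (sym (P≗pos i)) (sym (Q≗w i)) (position-upper I i)
    ρ : Λ s t w
    ρ = record
      { perm = reorder P Q
      ; linearExtension = reorder-linearExtension {t = t} 1≤s P Q
          (λ i → subst (λ y → s ≤ toℕ y) (sym (Q≗w i)) (s≤w i)) P<Q
          (λ i → subst₂ (λ p v → toℕ v + suc (toℕ i) ≤ toℕ p + s)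
            (sym (P≗pos i)) (sym (Q≗w i)) (position-lower I i))
      ; avoids321 = reorder-avoids321 P Q
      ; minima = λ x → mk⇔
          (fromQ ∘ Equivalence.to (reorder-minima P Q P<Q x))
          (Equivalence.from (reorder-minima P Q P<Q x) ∘ toQ)
      }
    placement : IsPlacement w (Ω.elem I) (reorder P Q)
    placement = record
      { placed = λ ℓ → inl P ℓ
          , trans (cong (ℤ.+_ ∘ label) (P≗pos ℓ)) (position-elem I ℓ)
          , trans (reorder-inl P Q ℓ) (Q≗w ℓ)
      ; others = λ x y x∉ y∉ → reorder-others P Q x y (toQ x∉) (toQ y∉)
      }
    unique : ∀ π → IsPlacement w (Ω.elem I) π → π ≈ reorder P Q
    unique π isPlacement = reorder-unique P Q π π-inl
      (λ x y x∉ y∉ → IsPlacement.others isPlacement x y (fromQ x∉) (fromQ y∉))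
      where
      π-inl : ∀ i → π ⟨$⟩ʳ inl P i ≡ inl Q i
      π-inl i with IsPlacement.placed isPlacement i
      ... | p , p-elem , πp≡w = trans (cong (π ⟨$⟩ʳ_) P≡p) (trans πp≡w (sym (Q≗w i)))
        where
        P≡p : inl P i ≡ p
        P≡p = trans (P≗pos i)
          (label-injective (ℤ.+-injective (trans (position-elem I i) (sym p-elem))))

-- Injectivity, and surjectivity for t = 2.

placement-injective : ∀ {n k} {w : Fin k → Fin n} {i j : Fin k → ℤ} {π ρ : Permutation′ n} →
  IsPlacement w i π → IsPlacement w j ρ → π ≈ ρ → i ≗ j
placement-injective {π = π} {ρ} isπ isρ π≈ρ ℓ
  with IsPlacement.placed isπ ℓ | IsPlacement.placed isρ ℓ
... | p , p≡i , πp≡w | q , q≡j , ρq≡w = trans (sym p≡i) (trans (cong (ℤ.+_ ∘ label) p≡q) q≡j)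
  where
  p≡q : p ≡ q
  p≡q = permutation-injective ρ (trans (sym (π≈ρ p)) (trans πp≡w (sym ρq≡w)))

placement-resp-≗ : ∀ {n k} {w : Fin k → Fin n} {i j : Fin k → ℤ} {π : Permutation′ n} →
  i ≗ j → IsPlacement w i π → IsPlacement w j π
placement-resp-≗ i≗j isπ = record
  { placed = λ ℓ → let p , p≡i , πp≡w = placed ℓ in p , trans p≡i (i≗j ℓ) , πp≡w
  ; others = others
  }
  where open IsPlacement isπ

-- The preimage consists of the positions of the elements of W. Once the word is recognised as a
-- merge, non-minimality of these elements gives the upper bounds and the linear extension property
-- gives the lower ones.
Λ⇒placement : ∀ {s k} {w : Fin k → Fin (s * 2)} → w Preserves _<_ ⟶ _<_ →
  (∀ ℓ → s + 1 ≤ label (w ℓ)) → (ρ : Λ s 2 w) →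
  Σ[ I ∈ Ω s 2 w ] IsPlacement w (Ω.elem I) (Λ.perm ρ)
Λ⇒placement {s} {k} {w} w↗ s<w ρ = fromShuffle (toShuffle w w↗)
  where
  open Λ ρ renaming (perm to π)

  ∈⇒nonminimum : ∀ ℓ → ¬ IsRightToLeftMin π (w ℓ)
  ∈⇒nonminimum ℓ min = Equivalence.to (minima (w ℓ)) min (ℓ , refl)

  pos : Fin k → Fin (s * 2)
  pos ℓ = π ⟨$⟩ˡ w ℓ

  pos↗ : pos Preserves _<_ ⟶ _<_
  pos↗ {i} i<j = nonminimum-before π avoids321 (∈⇒nonminimum i) (w↗ i<j)

  others : ∀ x y → x ∉ w → y ∉ w → x < y → π ⟨$⟩ˡ x < π ⟨$⟩ˡ y
  others x y _ y∉ = before-minimum π (Equivalence.from (minima y) y∉)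

  fromShuffle : ∃[ m ] Σ[ Q ∈ Shuffle k m (s * 2) ] inl Q ≗ w →
                Σ[ I ∈ Ω s 2 w ] IsPlacement w (Ω.elem I) π
  fromShuffle (m , Q , Q≗w) with toShuffleOf Q pos pos↗
  ... | P , P≗pos = I , record
    { placed = λ ℓ → pos ℓ , refl , inverseʳ π
    ; others = others
    }
    where
    fromQ : ∀ {x} → x ∉ inl Q → x ∉ w
    fromQ x∉ (i , eq) = x∉ (i , trans (Q≗w i) eq)
    π≈ : π ≈ reorder P Q
    π≈ = reorder-unique P Q π
      (λ i → trans (cong (π ⟨$⟩ʳ_) (P≗pos i)) (trans (inverseʳ π) (sym (Q≗w i))))
      (λ x y x∉ y∉ → others x y (fromQ x∉) (fromQ y∉))
    pos<w : ∀ ℓ → pos ℓ < w ℓ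
    pos<w ℓ = subst₂ _<_ (P≗pos ℓ) (Q≗w ℓ) (nonminimum⇒displaced P Q ℓ
      (λ min → ∈⇒nonminimum ℓ (minimum-resp-≈ {π = reorder P Q} {π} (λ p → sym (π≈ p))
        (subst (IsRightToLeftMin (reorder P Q)) (Q≗w ℓ) min))))
    w≤pos : ∀ ℓ → toℕ (w ℓ) + suc (toℕ ℓ) ≤ toℕ (pos ℓ) + s
    w≤pos ℓ = subst₂ (λ p v → toℕ v + suc (toℕ ℓ) ≤ toℕ p + s) (P≗pos ℓ) (Q≗w ℓ)
      (linearExtension⇒lower P Q
        (λ i → subst (λ y → s ≤ toℕ y) (sym (Q≗w i)) (<label⇒≤toℕ s (s<w i)))
        (linearExtension-resp-≈ {s} {2} {π} {reorder P Q} π≈ linearExtension) ℓ)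
    I : Ω s 2 w
    I = record
      { elem       = λ ℓ → ℤ.+ label (pos ℓ)
      ; increasing = λ i<j → +<+ (s<s (pos↗ i<j))
      ; lower      = λ ℓ → ⇒lower (label (w ℓ)) (label ℓ) s (s≤s (w≤pos ℓ))
      ; upper      = λ ℓ → +≤+ (pos<w ℓ)
      }

theorem3 : (s t : ℕ) → 2 ≤ s → 2 ≤ t →
    (k : ℕ) (w : Fin k → Fin (s * t)) →
    w Preserves _<_ ⟶ _<_ →
    (∀ ℓ → s + 1 ≤ label (w ℓ)) →
    Σ[ μ ∈ (Ω s t w → Λ s t w) ]
    (∀ I → IsPlacement w (Ω.elem I) (Λ.perm (μ I)) ×
    (∀ (π : Permutation′ (s * t)) → IsPlacement w (Ω.elem I) π → π ≈ Λ.perm (μ I))) ×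
    IsInjection (_≈Ω_ {s} {t} {k} {w}) (_≈Λ_ {s} {t} {k} {w}) μ ×
    (t ≡ 2 → IsBijection (_≈Ω_ {s} {t} {k} {w}) (_≈Λ_ {s} {t} {k} {w}) μ)
theorem3 s t 2≤s 2≤t k w w↗ s<w =
  μ , (λ I → proj₂ (exists I)) , isInjection , λ t≡2 → record
    { isInjection = isInjection
    -- Surjectivity asks about every `J` that agrees with `I`: the placement `isρ` is carried over
    -- to `J`, and uniqueness identifies `ρ` with the image of `J`.
    ; surjective  = λ ρ → let I , isρ = preimage t≡2 w↗ s<w ρ in
        I , λ {J} J≈I p → sym (unique J (Λ.perm ρ) (placement-resp-≗ (λ ℓ → sym (J≈I ℓ)) isρ) p)
    }
  where
  exists : ∀ I → _
  exists = placement-exists s<w w↗ (ℕ.<⇒≤ 2≤s)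
  μ : Ω s t w → Λ s t w
  μ I = proj₁ (exists I)
  placement : ∀ I → IsPlacement w (Ω.elem I) (Λ.perm (μ I))
  placement I = proj₁ (proj₂ (exists I))
  unique : ∀ I π → IsPlacement w (Ω.elem I) π → π ≈ Λ.perm (μ I)
  unique I = proj₂ (proj₂ (exists I))
  isInjection : IsInjection (_≈Ω_ {s} {t} {k} {w}) (_≈Λ_ {s} {t} {k} {w}) μ
  isInjection = record
    { isCongruent = record
      { cong = λ {I} {J} I≈J →
          unique J (Λ.perm (μ I)) (placement-resp-≗ I≈J (placement I))
      ; isEquivalence₁ = record
        { refl = λ _ → refl ; sym = λ p ℓ → sym (p ℓ) ; trans = λ p q ℓ → trans (p ℓ) (q ℓ) }
      ; isEquivalence₂ = record
        { refl = λ _ → refl ; sym = λ p i → sym (p i) ; trans = λ p q i → trans (p i) (q i) }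
      }
    ; injective = λ {I} {J} → placement-injective (placement I) (placement J)
    }
  -- Generalised over `t` and everything typed over it, so that `t ≡ 2` can be matched with `refl`.
  preimage : ∀ {t} → t ≡ 2 → {w : Fin k → Fin (s * t)} → w Preserves _<_ ⟶ _<_ →
    (∀ ℓ → s + 1 ≤ label (w ℓ)) → (ρ : Λ s t w) →
    Σ[ I ∈ Ω s t w ] IsPlacement w (Ω.elem I) (Λ.perm ρ)
  preimage refl = Λ⇒placement
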